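{- Let $a(x)=x+a_2x^2+a_3x^3+\cdots$ be a formal power series with complex coefficients. For $m\in\mathbb{N}$ define numbers $a(n,m)$ ($n\ge m$) by $$\frac{a(x)^m}{m!}=\sum_{n=m}^{\infty}a(n,m)\frac{x^n}{n!}.$$ Then for any $k,n\in\mathbb{N}$ we have $$a(n+k,n)=\sum_{r=1}^k\binom{k-n}{k-r}\binom{k+n}{k+r}a(k+r,r).$$
   Context: $\mathbb{N}$ is the set of positive integers. Binomial coefficients are generalized: for any number $z$ and integer $j\ge 0$, $\binom{z}{j}=\frac{z(z-1)\cdots(z-j+1)}{j!}$ (with $\binom z0=1$); in particular the upper entry may be negative. -}

module Defs where

open import Algebra.Bundles using (CommutativeRing)
open import Data.Bool.Base using (if_then_else_)
open import Data.Fin.Base using (toℕ)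
open import Data.Nat.Base using (ℕ; zero; suc; _∸_; _!; NonZero; _≤ᵇ_)
open import Data.Nat.Properties using (_!≢0)
open import Data.Product.Base using (proj₁; _×_)
open import Level using (_⊔_)
import Algebra.Definitions
import Algebra.Definitions.RawMonoid
import Algebra.Properties.CommutativeMonoid.Sum

-- The image of a natural number under the canonical map ℕ → R.
natural : ∀ {c ℓ} (R : CommutativeRing c ℓ) → ℕ → CommutativeRing.Carrier R
natural R n = n ·ℕ 1#
  where
  open CommutativeRing R using (1#; +-rawMonoid)
  open Algebra.Definitions.RawMonoid +-rawMonoid using () renaming (_×_ to infixr 8 _·ℕ_)

-- R is a commutative ℚ-algebra.  The complex numbers, like every field of
-- characteristic zero, satisfy this.
PositivesInvertible : ∀ {c ℓ} → CommutativeRing c ℓ → Set (c ⊔ ℓ)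
PositivesInvertible R = ∀ n .{{_ : NonZero n}} → Invertible 1# _*_ (natural R n)
  where
  open CommutativeRing R using (_≈_; _*_; 1#)
  open Algebra.Definitions _≈_ using (Invertible)

module Series {c ℓ} (R : CommutativeRing c ℓ) (inv : PositivesInvertible R) where

  open CommutativeRing R public using (Carrier; _≈_; _+_; _*_; _-_; 0#; 1#)
  open CommutativeRing R using (+-commutativeMonoid)
  open Algebra.Properties.CommutativeMonoid.Sum +-commutativeMonoid using (sum-syntax; sum⁺-syntax)

  ⟦_⟧ : ℕ → Carrier
  ⟦_⟧ = natural R

  1/_! : ℕ → Carrier
  1/ n ! = proj₁ (inv (n !) {{n !≢0}})

  ∑₁ : ℕ → (ℕ → Carrier) → Carrier
  ∑₁ k f = ∑[ i < k ] f (suc (toℕ i))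

  syntax ∑₁ k (λ r → t) = ∑[ r from1to k ] t

  -- z (z - 1) ⋯ (z - j + 1)
  falling : Carrier → ℕ → Carrier
  falling z zero    = 1#
  falling z (suc j) = falling z j * (z - ⟦ j ⟧)

  binom : Carrier → ℕ → Carrier
  binom z j = falling z j * 1/ j !

  -- A formal power series is its sequence of coefficients.
  PowerSeries : Set c
  PowerSeries = ℕ → Carrier

  infix  4 _≋_
  infixl 7 _⊛_ _•_
  infixr 8 _^_

  _≋_ : PowerSeries → PowerSeries → Set ℓ
  f ≋ g = ∀ n → f n ≈ g n

  _•_ : Carrier → PowerSeries → PowerSeries
  (s • f) n = s * f n

  one : PowerSeries
  one zero    = 1#
  one (suc _) = 0#

  _⊛_ : PowerSeries → PowerSeries → PowerSeries
  (f ⊛ g) n = ∑[ i ≤ n ] (f (toℕ i) * g (n ∸ toℕ i))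

  _^_ : PowerSeries → ℕ → PowerSeries
  f ^ zero  = one
  f ^ suc m = f ⊛ f ^ m

  -- f = x + f₂ x² + f₃ x³ + ⋯
  Normalised : PowerSeries → Set ℓ
  Normalised f = f 0 ≈ 0# × f 1 ≈ 1#

  -- ∑_{n ≥ m} u(n) xⁿ / n!
  egfFrom : ℕ → (ℕ → Carrier) → PowerSeries
  egfFrom m u n = if m ≤ᵇ n then u n * 1/ n ! else 0#

  -- The defining property of the numbers a(n,m), written A n m: for every
  -- m ≥ 1, a(x)ᵐ / m! = ∑_{n ≥ m} A n m xⁿ / n!.  It determines A n m for
  -- n ≥ m ≥ 1 and leaves the other values of A unconstrained.
  IsPowerArray : PowerSeries → (ℕ → ℕ → Carrier) → Set ℓ
  IsPowerArray a A =
    ∀ m .{{_ : NonZero m}} → 1/ m ! • (a ^ m) ≋ egfFrom m (λ n → A n m)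

{-# OPTIONS --safe #-}
module Submission where

open import Defs
open import Level using (Level; _⊔_)
open import Algebra.Bundles using (CommutativeRing)
open import Data.Bool.Base using (if_then_else_)
open import Data.Bool.Properties using (T-≡)
open import Data.Fin.Base using (zero; suc; toℕ)
open import Data.Nat.Base as ℕ using (ℕ; zero; suc; NonZero; _∸_; _!; _≤_; s≤s)
open import Data.Nat.Properties as ℕ using (≤⇒≤ᵇ; m≤n+m; m∸n≤m; ≤-trans)
open import Data.Product.Base using (_,_; _×_; proj₁; proj₂; Σ-syntax)
open import Data.Vec.Functional using (Vector)
open import Function.Base using (_∘_)
open import Function.Bundles using (Equivalence)
open import Relation.Binary.PropositionalEquality as ≡ using (_≡_)
import Algebra.Properties.AbelianGroup
import Algebra.Properties.Semiring.Mult
import Algebra.Properties.Semiring.Sum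
import Algebra.Solver.Ring.NaturalCoefficients.Default
import Relation.Binary.Reasoning.Setoid

-- Write a(x) = x g(x) with g(0) = 1 and P(m) = [x^k] g(x)^m, so that
-- A (k + m) m = (k + m)! / m! · P(m).  Since g - 1 has no constant term, P is a
-- polynomial in m of degree at most k, and P(0) = 0.  After division by
-- (k + n)! / n! the identity says that P is recovered from its values at
-- 0, …, k by Lagrange interpolation, whose basis polynomials are
-- n ↦ binom (k - n) (k - r) · binom n r.

module Interpolation {c ℓ} (R : CommutativeRing c ℓ) (inv : PositivesInvertible R) where

  open Series R inv
  open CommutativeRing R
    hiding (Carrier; _≈_; _+_; _*_; _-_; 0#; 1#; zero)
  open Algebra.Properties.AbelianGroup +-abelianGroup using (⁻¹-∙-comm; //-rightDividesˡ; //-rightDividesʳ)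
  open Algebra.Properties.Semiring.Mult semiring using (×-homo-+; ×1-homo-*)
  open Algebra.Properties.Semiring.Sum semiring
    using (sum; sum-cong-≋; ∑-distrib-+; *-distribˡ-sum)
  open Algebra.Solver.Ring.NaturalCoefficients.Default commutativeSemiring
    using (solve; _:+_; _:*_; _:=_)
  open Relation.Binary.Reasoning.Setoid setoid

  -- Formal power series: addition, and multiplication by powers of x.

  infixl 6 _⊕_

  _⊕_ : PowerSeries → PowerSeries → PowerSeries
  (f ⊕ g) n = f n + g n

  shift : PowerSeries → PowerSeries
  shift f zero    = 0#
  shift f (suc n) = f n

  shift-cong : ∀ {f g} → f ≋ g → shift f ≋ shift g
  shift-cong f≋g zero    = refl
  shift-cong f≋g (suc n) = f≋g n

  ⊛-cong : ∀ {f f′ g g′} → f ≋ f′ → g ≋ g′ → f ⊛ g ≋ f′ ⊛ g′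
  ⊛-cong f≋f′ g≋g′ n = sum-cong-≋ {suc n} λ i → *-cong (f≋f′ (toℕ i)) (g≋g′ (n ∸ toℕ i))

  ⊛-distribˡ-⊕ : ∀ f g h → f ⊛ (g ⊕ h) ≋ f ⊛ g ⊕ f ⊛ h
  ⊛-distribˡ-⊕ f g h n = trans
    (sum-cong-≋ {suc n} λ i → distribˡ (f (toℕ i)) (g (n ∸ toℕ i)) (h (n ∸ toℕ i)))
    (∑-distrib-+ {suc n} (λ i → f (toℕ i) * g (n ∸ toℕ i)) (λ i → f (toℕ i) * h (n ∸ toℕ i)))

  ⊛-distribʳ-⊕ : ∀ f g h → (g ⊕ h) ⊛ f ≋ g ⊛ f ⊕ h ⊛ f
  ⊛-distribʳ-⊕ f g h n = trans
    (sum-cong-≋ {suc n} λ i → distribʳ (f (n ∸ toℕ i)) (g (toℕ i)) (h (toℕ i)))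
    (∑-distrib-+ {suc n} (λ i → g (toℕ i) * f (n ∸ toℕ i)) (λ i → h (toℕ i) * f (n ∸ toℕ i)))

  -- The tail `f ∘ suc` is again constant, with constant term zero, so induction kills everything
  -- after the first summand.
  constant-⊛ : ∀ f g → (∀ n → f (suc n) ≈ 0#) → f ⊛ g ≋ f 0 • g
  constant-⊛ f g f≈0 zero    = +-identityʳ _
  constant-⊛ f g f≈0 (suc n) =
    trans (+-congˡ (trans (constant-⊛ (f ∘ suc) g (f≈0 ∘ suc) n) (trans (*-congʳ (f≈0 0)) (zeroˡ _)))) (+-identityʳ _)

  shift-⊛ : ∀ f g → shift f ⊛ g ≋ shift (f ⊛ g)
  shift-⊛ f g zero    = trans (+-identityʳ _) (zeroˡ _)
  shift-⊛ f g (suc n) = trans (+-congʳ (zeroˡ _)) (+-identityˡ _)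

  -- The convolution is indexed by its left factor, so here the vanishing summand is the last one;
  -- it is reached by peeling coefficients off `f`.
  ⊛-shift : ∀ f g → f ⊛ shift g ≋ shift (f ⊛ g)
  ⊛-shift f g zero          = trans (+-identityʳ _) (zeroʳ _)
  -- Index one is split off because `shift` in the induction hypothesis reduces only on a
  -- constructor.
  ⊛-shift f g (suc zero)    = +-congˡ (⊛-shift (f ∘ suc) g 0)
  ⊛-shift f g (suc (suc n)) = +-congˡ (⊛-shift (f ∘ suc) g (suc n))

  shiftBy : ℕ → PowerSeries → PowerSeries
  shiftBy zero    f = f
  shiftBy (suc m) f = shift (shiftBy m f)

  shiftBy-+ : ∀ m f k → shiftBy m f (m ℕ.+ k) ≡ f k
  shiftBy-+ zero    f k = ≡.refl
  shiftBy-+ (suc m) f k = shiftBy-+ m f k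

  ⊛-shiftBy : ∀ m f g → f ⊛ shiftBy m g ≋ shiftBy m (f ⊛ g)
  ⊛-shiftBy zero    f g n = refl
  ⊛-shiftBy (suc m) f g n =
    trans (⊛-shift f (shiftBy m g) n) (shift-cong (⊛-shiftBy m f g) n)

  -- Writing a = x g with g = `a ∘ suc`, each new factor contributes one x, which is moved to the
  -- front: a^m = x^m g^m.
  ^-shift : ∀ {a} → a 0 ≈ 0# → ∀ m → a ^ m ≋ shiftBy m ((a ∘ suc) ^ m)
  ^-shift {a} a₀≈0 zero    n = refl
  ^-shift {a} a₀≈0 (suc m) n = begin
    (a ⊛ a ^ m) n                         ≈⟨ ⊛-cong a≋shift (^-shift a₀≈0 m) n ⟩
    (shift g ⊛ shiftBy m (g ^ m)) n       ≈⟨ shift-⊛ g _ n ⟩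
    shift (g ⊛ shiftBy m (g ^ m)) n       ≈⟨ shift-cong (⊛-shiftBy m g (g ^ m)) n ⟩
    shift (shiftBy m (g ⊛ g ^ m)) n       ∎
    where
    g = a ∘ suc
    a≋shift : a ≋ shift g
    a≋shift zero    = a₀≈0
    a≋shift (suc n) = refl

  -- Polynomial functions on the natural numbers, by iterated differences.

  -- Differences are given as witnesses so that no subtraction occurs.
  Degree≤ : ℕ → (ℕ → Carrier) → Set (c ⊔ ℓ)
  Degree≤ zero    f = Σ[ s ∈ Carrier ] (∀ n → f n ≈ s)
  Degree≤ (suc d) f = Σ[ δ ∈ (ℕ → Carrier) ] ((∀ n → f (suc n) ≈ f n + δ n) × Degree≤ d δ)

  Degree≤-constant : ∀ d s → Degree≤ d (λ _ → s)
  Degree≤-constant zero    s = s , λ _ → refl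
  Degree≤-constant (suc d) s = (λ _ → 0#) , (λ _ → sym (+-identityʳ s)) , Degree≤-constant d 0#

  Degree≤-cong : ∀ d {f g} → (∀ n → f n ≈ g n) → Degree≤ d f → Degree≤ d g
  Degree≤-cong zero    f≈g (s , f≈s)     = s , λ n → trans (sym (f≈g n)) (f≈s n)
  Degree≤-cong (suc d) f≈g (δ , step , D) =
    δ , (λ n → trans (sym (f≈g (suc n))) (trans (step n) (+-congʳ (f≈g n)))) , D

  Degree≤-+ : ∀ d {f g} → Degree≤ d f → Degree≤ d g → Degree≤ d (λ n → f n + g n)
  Degree≤-+ zero (s , f≈s) (t , g≈t) = s + t , λ n → +-cong (f≈s n) (g≈t n)
  Degree≤-+ (suc d) {f} {g} (δ , f-step , D) (ε , g-step , E) =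
    (λ n → δ n + ε n) ,
    (λ n → trans (+-cong (f-step n) (g-step n))
      (solve 4 (λ p q u v → (p :+ u) :+ (q :+ v) := (p :+ q) :+ (u :+ v)) refl (f n) (g n) (δ n) (ε n))) ,
    Degree≤-+ d D E

  Degree≤-* : ∀ d s {f} → Degree≤ d f → Degree≤ d (λ n → s * f n)
  Degree≤-* zero    s (t , f≈t)      = s * t , λ n → *-congˡ (f≈t n)
  Degree≤-* (suc d) s (δ , step , D) =
    (λ n → s * δ n) , (λ n → trans (*-congˡ (step n)) (distribˡ s _ _)) , Degree≤-* d s D

  Degree≤-sum : ∀ d {p} (f : ℕ → Vector Carrier p) →
    (∀ i → Degree≤ d (λ n → f n i)) → Degree≤ d (λ n → sum (f n))
  Degree≤-sum d {zero}  f D = Degree≤-constant d 0#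
  Degree≤-sum d {suc p} f D = Degree≤-+ d (D zero) (Degree≤-sum d (λ n → f n ∘ suc) (D ∘ suc))

  -- Since g(0) = 1, comparing g^(m+1) = g g^m with g^m shows that the difference in m of a
  -- coefficient is a fixed linear combination of strictly lower coefficients of g^m. The slack
  -- `k ≤ d` gives all of these the common bound that the sum requires.
  coefficient-degree : ∀ {g} → g 0 ≈ 1# → ∀ d k → k ≤ d → Degree≤ d (λ m → (g ^ m) k)
  coefficient-degree {g} g₀≈1 d zero k≤d =
    Degree≤-cong d (sym ∘ constantTerm) (Degree≤-constant d 1#)
    where
    constantTerm : ∀ m → (g ^ m) 0 ≈ 1#
    constantTerm zero    = refl
    constantTerm (suc m) =
      trans (+-identityʳ _) (trans (*-cong g₀≈1 (constantTerm m)) (*-identityˡ 1#))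
  coefficient-degree {g} g₀≈1 (suc d) (suc k) (s≤s k≤d) =
    (λ m → ((g ∘ suc) ⊛ g ^ m) k) ,
    (λ m → +-congʳ (trans (*-congʳ g₀≈1) (*-identityˡ _))) ,
    Degree≤-sum d {suc k} (λ m i → g (suc (toℕ i)) * (g ^ m) (k ∸ toℕ i)) λ i →
      Degree≤-* d (g (suc (toℕ i)))
        (coefficient-degree g₀≈1 d (k ∸ toℕ i) (≤-trans (m∸n≤m k (toℕ i)) k≤d))

  -- Falling factorials and generalized binomial coefficients.

  ⟦⟧-+ : ∀ m n → ⟦ m ℕ.+ n ⟧ ≈ ⟦ m ⟧ + ⟦ n ⟧
  ⟦⟧-+ = ×-homo-+ 1#

  -‿cancelʳ : ∀ x y z → (x + z) - (y + z) ≈ x - y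
  -‿cancelʳ x y z = begin
    (x + z) - (y + z)          ≈⟨ +-congˡ (⁻¹-∙-comm y z) ⟨
    -- With the negation distributed, `- y` and `- z` enter the semiring solver as atoms.
    (x + z) + (- y + - z)      ≈⟨ solve 4 (λ x z u v → (x :+ z) :+ (u :+ v) := ((x :+ u) :+ z) :+ v) refl x z (- y) (- z) ⟩
    ((x - y) + z) - z          ≈⟨ //-rightDividesʳ z (x - y) ⟩
    x - y                      ∎

  falling-cong : ∀ {y z} → y ≈ z → ∀ j → falling y j ≈ falling z j
  falling-cong y≈z zero    = refl
  falling-cong y≈z (suc j) = *-cong (falling-cong y≈z j) (+-congʳ y≈z)

  -- The factors after the first `k` are those of the falling factorial of z - k. This number is
  -- passed as `y` with y + k = z, so that it can be a natural number when `z` is one.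
  falling-+ : ∀ {y z} k → y + ⟦ k ⟧ ≈ z → ∀ j → falling z (k ℕ.+ j) ≈ falling z k * falling y j
  falling-+ {y} {z} k y+k≈z zero = begin
    falling z (k ℕ.+ 0)  ≡⟨ ≡.cong (falling z) (ℕ.+-identityʳ k) ⟩
    falling z k          ≈⟨ *-identityʳ _ ⟨
    falling z k * 1#     ∎
  falling-+ {y} {z} k y+k≈z (suc j) = begin
    falling z (k ℕ.+ suc j)                           ≡⟨ ≡.cong (falling z) (ℕ.+-suc k j) ⟩
    falling z (k ℕ.+ j) * (z - ⟦ k ℕ.+ j ⟧)           ≈⟨ *-cong (falling-+ k y+k≈z j) factor ⟩
    falling z k * falling y j * (y - ⟦ j ⟧)           ≈⟨ *-assoc _ _ _ ⟩
    falling z k * (falling y j * (y - ⟦ j ⟧))         ∎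
    where
    factor : z - ⟦ k ℕ.+ j ⟧ ≈ y - ⟦ j ⟧
    factor = begin
      z - ⟦ k ℕ.+ j ⟧                 ≈⟨ +-cong (sym y+k≈z) (-‿cong (trans (⟦⟧-+ k j) (+-comm _ _))) ⟩
      (y + ⟦ k ⟧) - (⟦ j ⟧ + ⟦ k ⟧)   ≈⟨ -‿cancelʳ y ⟦ j ⟧ ⟦ k ⟧ ⟩
      y - ⟦ j ⟧                       ∎

  -- The definition of `falling` splits off the last factor; this splits off the first.
  falling-suc : ∀ z j → falling (z + 1#) (suc j) ≈ (z + 1#) * falling z j
  falling-suc z j = trans (falling-+ 1 (+-congˡ (+-identityʳ 1#)) j) (*-congʳ (begin
    1# * (z + 1# - 0#)     ≈⟨ *-identityˡ _ ⟩
    z + 1# - 0#            ≈⟨ +-identityʳ _ ⟨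
    z + 1# - 0# + 0#       ≈⟨ //-rightDividesˡ 0# (z + 1#) ⟩
    z + 1#                 ∎))

  falling-0 : ∀ j → falling 0# (suc j) ≈ 0#
  falling-0 zero    = trans (*-identityˡ _) (-‿inverseʳ 0#)
  falling-0 (suc j) = trans (*-congʳ (falling-0 j)) (zeroˡ _)

  ⟦suc⟧ : ∀ n → ⟦ suc n ⟧ ≈ ⟦ n ⟧ + 1#
  ⟦suc⟧ n = +-comm 1# ⟦ n ⟧

  falling-! : ∀ n → falling ⟦ n ⟧ n ≈ ⟦ n ! ⟧
  falling-! zero    = sym (+-identityʳ 1#)
  falling-! (suc n) = begin
    falling ⟦ suc n ⟧ (suc n)          ≈⟨ falling-cong (⟦suc⟧ n) (suc n) ⟩
    falling (⟦ n ⟧ + 1#) (suc n)       ≈⟨ falling-suc ⟦ n ⟧ n ⟩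
    (⟦ n ⟧ + 1#) * falling ⟦ n ⟧ n     ≈⟨ *-cong (sym (⟦suc⟧ n)) (falling-! n) ⟩
    ⟦ suc n ⟧ * ⟦ n ! ⟧                ≈⟨ ×1-homo-* (suc n) (n !) ⟨
    ⟦ suc n ! ⟧                        ∎

  1/!-inverseʳ : ∀ n → ⟦ n ! ⟧ * 1/ n ! ≈ 1#
  1/!-inverseʳ n = proj₂ (proj₂ (inv (n !) {{n ℕ.!≢0}}))

  -- `inv` yields an inverse for each factorial separately, so consecutive ones are related only
  -- through the inverse laws.
  1/!-suc : ∀ n → ⟦ suc n ⟧ * 1/ suc n ! ≈ 1/ n !
  1/!-suc n = begin
    ⟦ suc n ⟧ * 1/ suc n !                             ≈⟨ *-identityʳ _ ⟨
    ⟦ suc n ⟧ * 1/ suc n ! * 1#                        ≈⟨ *-congˡ (1/!-inverseʳ n) ⟨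
    ⟦ suc n ⟧ * 1/ suc n ! * (⟦ n ! ⟧ * 1/ n !)        ≈⟨ solve 4 (λ s t u v → s :* t :* (u :* v) := s :* u :* t :* v) refl
                                                            ⟦ suc n ⟧ (1/ suc n !) ⟦ n ! ⟧ (1/ n !) ⟩
    ⟦ suc n ⟧ * ⟦ n ! ⟧ * 1/ suc n ! * 1/ n !          ≈⟨ *-congʳ (*-congʳ (×1-homo-* (suc n) (n !))) ⟨
    ⟦ suc n ! ⟧ * 1/ suc n ! * 1/ n !                  ≈⟨ *-congʳ (1/!-inverseʳ (suc n)) ⟩
    1# * 1/ n !                                        ≈⟨ *-identityˡ _ ⟩
    1/ n !                                             ∎

  binom-cong : ∀ {y z} → y ≈ z → binom y ≋ binom z
  binom-cong y≈z j = *-congʳ (falling-cong y≈z j)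

  binom-zero : ∀ z → binom z 0 ≈ 1#
  binom-zero z = trans (*-congʳ (sym (+-identityʳ 1#))) (1/!-inverseʳ 0)

  binom-diagonal : ∀ n → binom ⟦ n ⟧ n ≈ 1#
  binom-diagonal n = trans (*-congʳ (falling-! n)) (1/!-inverseʳ n)

  -- Read as a series, `binom z` is (1+x)^z, and this is multiplication by 1+x.
  binom-pascal : ∀ z → binom (z + 1#) ≋ binom z ⊕ shift (binom z)
  binom-pascal z zero    = sym (+-identityʳ _)
  binom-pascal z (suc j) = begin
    falling (z + 1#) (suc j) * I′               ≈⟨ *-congʳ (falling-suc z j) ⟩
    (z + 1#) * F * I′                           ≈⟨ *-congʳ (*-congʳ split) ⟩
    -- The summand z - j prolongs the falling factorial; the summand j + 1 cancels against (j+1)!.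
    ((z - ⟦ j ⟧) + ⟦ suc j ⟧) * F * I′          ≈⟨ solve 4 (λ d s F I → (d :+ s) :* F :* I := F :* d :* I :+ F :* (s :* I)) refl
                                                     (z - ⟦ j ⟧) ⟦ suc j ⟧ F I′ ⟩
    F * (z - ⟦ j ⟧) * I′ + F * (⟦ suc j ⟧ * I′) ≈⟨ +-congˡ (*-congˡ (1/!-suc j)) ⟩
    binom z (suc j) + binom z j                 ∎
    where
    F  = falling z j
    I′ = 1/ suc j !
    split : z + 1# ≈ (z - ⟦ j ⟧) + ⟦ suc j ⟧
    split = begin
      z + 1#                        ≈⟨ +-congʳ (//-rightDividesˡ ⟦ j ⟧ z) ⟨
      (z - ⟦ j ⟧) + ⟦ j ⟧ + 1#      ≈⟨ +-assoc _ _ _ ⟩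
      (z - ⟦ j ⟧) + (⟦ j ⟧ + 1#)    ≈⟨ +-congˡ (⟦suc⟧ j) ⟨
      (z - ⟦ j ⟧) + ⟦ suc j ⟧       ∎

  -- Lagrange interpolation as a convolution.

  weighted : Carrier → (ℕ → Carrier) → PowerSeries
  weighted y f r = binom y r * f r

  -- For z = k - y, the coefficient of x^k is the Lagrange interpolant of `f` at the nodes 0, ...,
  -- k, evaluated at `y`. Keeping `z` independent of `y` and `k` allows a Pascal rule in each
  -- variable. Formally the series is (1+x)^z (1+xE)^y f at 0, where E f = `f ∘ suc`.
  interpolant : Carrier → Carrier → (ℕ → Carrier) → PowerSeries
  interpolant z y f = weighted y f ⊛ binom z

  interpolant-cong : ∀ z y {f g} → (∀ n → f n ≈ g n) → interpolant z y f ≋ interpolant z y g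
  interpolant-cong z y {f} {g} f≈g = ⊛-cong {f = weighted y f} {g = binom z} (λ r → *-congˡ {binom y r} (f≈g r)) (λ _ → refl)

  interpolant-+ : ∀ z y f g → interpolant z y (λ n → f n + g n) ≋ interpolant z y f ⊕ interpolant z y g
  interpolant-+ z y f g k = trans
    (⊛-cong {g = binom z} (λ r → distribˡ (binom y r) (f r) (g r)) (λ _ → refl) k)
    (⊛-distribʳ-⊕ (binom z) (weighted y f) (weighted y g) k)

  -- Pascal's rule lowers the index of the binomial coefficient but not the argument of `f`;
  -- realigning the two replaces `f` by `f ∘ suc`. Formally this is multiplication by 1+xE.
  interpolant-pascalʳ : ∀ z y f →
    interpolant z (y + 1#) f ≋ interpolant z y f ⊕ shift (interpolant z y (f ∘ suc))
  interpolant-pascalʳ z y f k = begin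
    interpolant z (y + 1#) f k
      ≈⟨ ⊛-cong {g = binom z} pascal (λ _ → refl) k ⟩
    ((weighted y f ⊕ shift (weighted y (f ∘ suc))) ⊛ binom z) k
      ≈⟨ ⊛-distribʳ-⊕ (binom z) (weighted y f) (shift (weighted y (f ∘ suc))) k ⟩
    interpolant z y f k + (shift (weighted y (f ∘ suc)) ⊛ binom z) k
      ≈⟨ +-congˡ (shift-⊛ (weighted y (f ∘ suc)) (binom z) k) ⟩
    interpolant z y f k + shift (interpolant z y (f ∘ suc)) k ∎
    where
    pascal : weighted (y + 1#) f ≋ weighted y f ⊕ shift (weighted y (f ∘ suc))
    pascal zero    = sym (+-identityʳ _)
    pascal (suc r) = trans (*-congʳ (binom-pascal y (suc r))) (distribʳ _ _ _)

  interpolant-pascalˡ : ∀ z y f →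
    interpolant (z + 1#) y f ≋ interpolant z y f ⊕ shift (interpolant z y f)
  interpolant-pascalˡ z y f k = begin
    interpolant (z + 1#) y f k
      ≈⟨ ⊛-cong {f = weighted y f} (λ _ → refl) (binom-pascal z) k ⟩
    (weighted y f ⊛ (binom z ⊕ shift (binom z))) k
      ≈⟨ ⊛-distribˡ-⊕ (weighted y f) (binom z) (shift (binom z)) k ⟩
    interpolant z y f k + (weighted y f ⊛ shift (binom z)) k
      ≈⟨ +-congˡ (⊛-shift (weighted y f) (binom z) k) ⟩
    interpolant z y f k + shift (interpolant z y f) k ∎

  -- With E f = f + δ, the two Pascal rules combine: raising n by one in the
  -- interpolant of order suc k raises z by one and adds the interpolant of δ
  -- of order k, so z + n = k is preserved in both summands.
  interpolation : ∀ n k z {f} → z + ⟦ n ⟧ ≈ ⟦ k ⟧ → Degree≤ k f → interpolant z ⟦ n ⟧ f k ≈ f n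
  interpolation zero k z {f} z+n≈k D = begin
    interpolant z ⟦ 0 ⟧ f k       ≈⟨ constant-⊛ (weighted ⟦ 0 ⟧ f) (binom z) vanish k ⟩
    -- Only r = 0 survives, and z = k turns its last factor into 1.
    binom 0# 0 * f 0 * binom z k  ≈⟨ *-cong (*-congʳ (binom-zero 0#)) (trans (binom-cong (trans (sym (+-identityʳ z)) z+n≈k) k) (binom-diagonal k)) ⟩
    1# * f 0 * 1#                 ≈⟨ trans (*-identityʳ _) (*-identityˡ _) ⟩
    f 0                           ∎
    where
    vanish : ∀ r → binom 0# (suc r) * f (suc r) ≈ 0#
    vanish r = trans (*-congʳ (trans (*-congʳ (falling-0 r)) (zeroˡ _))) (zeroˡ _)
  interpolation (suc n) zero z {f} z+n≈k (s , f≈s) = begin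
    binom ⟦ suc n ⟧ 0 * f 0 * binom z 0 + 0#  ≈⟨ +-identityʳ _ ⟩
    binom ⟦ suc n ⟧ 0 * f 0 * binom z 0       ≈⟨ *-cong (*-congʳ (binom-zero ⟦ suc n ⟧)) (binom-zero z) ⟩
    1# * f 0 * 1#                             ≈⟨ trans (*-identityʳ _) (*-identityˡ _) ⟩
    -- The single node 0 suffices because `f` is constant.
    f 0                                       ≈⟨ trans (f≈s 0) (sym (f≈s (suc n))) ⟩
    f (suc n)                                 ∎
  interpolation (suc n) (suc k) z {f} z+n≈k D@(δ , step , Dδ) = begin
    interpolant z ⟦ suc n ⟧ f (suc k)
      ≈⟨ ⊛-cong {g = binom z} (λ r → *-congʳ {f r} (binom-cong (⟦suc⟧ n) r)) (λ _ → refl) (suc k) ⟩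
    interpolant z (y + 1#) f (suc k)
      ≈⟨ interpolant-pascalʳ z y f (suc k) ⟩
    interpolant z y f (suc k) + interpolant z y (f ∘ suc) k
      ≈⟨ +-congˡ (trans (interpolant-cong z y step k) (interpolant-+ z y f δ k)) ⟩
    interpolant z y f (suc k) + (interpolant z y f k + interpolant z y δ k)
      ≈⟨ +-assoc _ _ _ ⟨
    interpolant z y f (suc k) + interpolant z y f k + interpolant z y δ k
      ≈⟨ +-congʳ (interpolant-pascalˡ z y f (suc k)) ⟨
    interpolant (z + 1#) y f (suc k) + interpolant z y δ k
      ≈⟨ +-cong (interpolation n (suc k) (z + 1#) (trans (+-assoc z 1# y) z+n≈k) D) (interpolation n k z z+y≈k Dδ) ⟩
    f n + δ n
      ≈⟨ step n ⟨
    f (suc n) ∎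
    where
    y = ⟦ n ⟧
    z+y≈k : z + y ≈ ⟦ k ⟧
    z+y≈k = begin
      z + y                  ≈⟨ //-rightDividesʳ 1# (z + y) ⟨
      (z + y) + 1# - 1#      ≈⟨ +-congʳ (solve 3 (λ z y u → (z :+ y) :+ u := z :+ (u :+ y)) refl z y 1#) ⟩
      (z + ⟦ suc n ⟧) - 1#   ≈⟨ +-congʳ (trans z+n≈k (⟦suc⟧ k)) ⟩
      (⟦ k ⟧ + 1#) - 1#      ≈⟨ //-rightDividesʳ 1# ⟦ k ⟧ ⟩
      ⟦ k ⟧                  ∎

  -- Transfer to the array `A`.

  egfFrom-≤ : ∀ {m n} u → m ≤ n → egfFrom m u n ≡ u n * 1/ n !
  egfFrom-≤ {m} {n} u m≤n =
    ≡.cong (λ b → if b then u n * 1/ n ! else 0#) (Equivalence.to T-≡ (≤⇒≤ᵇ m≤n))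

  module _ {a} (a-normalised : Normalised a) {A} (A-array : IsPowerArray a A) where

    g : PowerSeries
    g = a ∘ suc

    array-coefficient : ∀ k m .{{_ : NonZero m}} → A (k ℕ.+ m) m * 1/ (k ℕ.+ m) ! ≈ 1/ m ! * (g ^ m) k
    array-coefficient k m = begin
      A (k ℕ.+ m) m * 1/ (k ℕ.+ m) !      ≡⟨ egfFrom-≤ (λ n → A n m) (m≤n+m m k) ⟨
      egfFrom m (λ n → A n m) (k ℕ.+ m)   ≈⟨ A-array m (k ℕ.+ m) ⟨
      1/ m ! * (a ^ m) (k ℕ.+ m)          ≡⟨ ≡.cong (λ N → 1/ m ! * (a ^ m) N) (ℕ.+-comm k m) ⟩
      1/ m ! * (a ^ m) (m ℕ.+ k)          ≈⟨ *-congˡ (^-shift (proj₁ a-normalised) m (m ℕ.+ k)) ⟩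
      1/ m ! * shiftBy m (g ^ m) (m ℕ.+ k) ≡⟨ ≡.cong (1/ m ! *_) (shiftBy-+ m (g ^ m) k) ⟩
      1/ m ! * (g ^ m) k                  ∎

    -- The factor (k+r)! in A(k+r,r) cancels the denominator of the binomial coefficient, and the
    -- falling factorial of k+n splits after `k` factors. What remains outside the interpolation
    -- term, (k+n)!/n!, is independent of `r` and can leave the sum.
    binom-array : ∀ k n r .{{_ : NonZero r}} →
      binom ⟦ k ℕ.+ n ⟧ (k ℕ.+ r) * A (k ℕ.+ r) r ≈
      falling ⟦ k ℕ.+ n ⟧ k * weighted ⟦ n ⟧ (λ m → (g ^ m) k) r
    binom-array k n r = begin
      falling N (k ℕ.+ r) * I * A′                  ≈⟨ solve 3 (λ F I A → F :* I :* A := F :* (A :* I)) refl (falling N (k ℕ.+ r)) I A′ ⟩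
      falling N (k ℕ.+ r) * (A′ * I)                ≈⟨ *-cong (falling-+ k (trans (+-comm _ _) (sym (⟦⟧-+ k n))) r) (array-coefficient k r) ⟩
      falling N k * falling ⟦ n ⟧ r * (1/ r ! * P)  ≈⟨ solve 4 (λ F G J P → F :* G :* (J :* P) := F :* (G :* J :* P)) refl
                                                         (falling N k) (falling ⟦ n ⟧ r) (1/ r !) P ⟩
      falling N k * (binom ⟦ n ⟧ r * P)             ∎
      where
      N  = ⟦ k ℕ.+ n ⟧
      I  = 1/ (k ℕ.+ r) !
      A′ = A (k ℕ.+ r) r
      P  = (g ^ r) k

    array-interpolation : ∀ k n .{{_ : NonZero k}} .{{_ : NonZero n}} →
      A (n ℕ.+ k) n ≈
        ∑[ r from1to k ]
          (binom (⟦ k ⟧ - ⟦ n ⟧) (k ∸ r) * binom ⟦ k ℕ.+ n ⟧ (k ℕ.+ r) * A (k ℕ.+ r) r)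
    array-interpolation k@(suc k′) n = begin
      A (n ℕ.+ k) n                                   ≡⟨ ≡.cong (λ N → A N n) (ℕ.+-comm n k) ⟩
      A (k ℕ.+ n) n                                   ≈⟨ *-identityˡ _ ⟨
      1# * A (k ℕ.+ n) n                              ≈⟨ *-congʳ (binom-diagonal (k ℕ.+ n)) ⟨
      -- The left side of the identity is itself the case r = n of `binom-array`, whether or not n
      -- exceeds k.
      binom ⟦ k ℕ.+ n ⟧ (k ℕ.+ n) * A (k ℕ.+ n) n     ≈⟨ binom-array k n n ⟩
      C * (binom ⟦ n ⟧ n * P n)                       ≈⟨ *-congˡ (trans (*-congʳ (binom-diagonal n)) (*-identityˡ _)) ⟩
      C * P n                                         ≈⟨ *-congˡ (interpolation n k z (//-rightDividesˡ ⟦ n ⟧ ⟦ k ⟧)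
                                                           (coefficient-degree (proj₂ a-normalised) k k ℕ.≤-refl)) ⟨
      -- The node r = 0 drops out: P(0) is the coefficient of x^k in the series 1, which reduces to
      -- `0#` because `k` is a successor. Hence the sum starts at r = 1.
      C * interpolant z ⟦ n ⟧ P k                     ≈⟨ *-congˡ (trans (+-congʳ P₀-term) (+-identityˡ _)) ⟩
      C * ∑₁ k (λ r → weighted ⟦ n ⟧ P r * binom z (k ∸ r)) ≈⟨ *-distribˡ-sum {k} C (λ i → weighted ⟦ n ⟧ P (suc (toℕ i)) * binom z (k′ ∸ toℕ i)) ⟩
      ∑₁ k (λ r → C * (weighted ⟦ n ⟧ P r * binom z (k ∸ r))) ≈⟨ sum-cong-≋ {k} (λ i → term (suc (toℕ i))) ⟩
      ∑₁ k (λ r → binom z (k ∸ r) * binom ⟦ k ℕ.+ n ⟧ (k ℕ.+ r) * A (k ℕ.+ r) r) ∎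
      where
      z = ⟦ k ⟧ - ⟦ n ⟧
      C = falling ⟦ k ℕ.+ n ⟧ k
      P : ℕ → Carrier
      P m = (g ^ m) k

      P₀-term : binom ⟦ n ⟧ 0 * 0# * binom z k ≈ 0#
      P₀-term = trans (*-congʳ (zeroʳ _)) (zeroˡ _)

      term : ∀ r .{{_ : NonZero r}} →
        C * (weighted ⟦ n ⟧ P r * binom z (k ∸ r)) ≈
        binom z (k ∸ r) * binom ⟦ k ℕ.+ n ⟧ (k ℕ.+ r) * A (k ℕ.+ r) r
      term r = begin
        C * (weighted ⟦ n ⟧ P r * B)                       ≈⟨ solve 3 (λ C W B → C :* (W :* B) := B :* (C :* W)) refl C (weighted ⟦ n ⟧ P r) B ⟩
        B * (C * weighted ⟦ n ⟧ P r)                       ≈⟨ *-congˡ (binom-array k n r) ⟨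
        B * (binom ⟦ k ℕ.+ n ⟧ (k ℕ.+ r) * A (k ℕ.+ r) r)  ≈⟨ *-assoc _ _ _ ⟨
        B * binom ⟦ k ℕ.+ n ⟧ (k ℕ.+ r) * A (k ℕ.+ r) r    ∎
        where
        B = binom z (k ∸ r)

theorem2p2 : ∀ {c ℓ : Level} (R : CommutativeRing c ℓ) (inv : PositivesInvertible R) →
    let open Series R inv in
    (a : PowerSeries) → Normalised a →
    (A : ℕ → ℕ → Carrier) → IsPowerArray a A →
    ∀ (k n : ℕ) .{{_ : NonZero k}} .{{_ : NonZero n}} →
    A (n ℕ.+ k) n ≈
    ∑[ r from1to k ]
    (binom (⟦ k ⟧ - ⟦ n ⟧) (k ∸ r) * binom ⟦ k ℕ.+ n ⟧ (k ℕ.+ r) * A (k ℕ.+ r) r)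
theorem2p2 R inv a a-normalised A A-array k n =
  Interpolation.array-interpolation R inv a-normalised A-array k n
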